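{- Let $\Bbbk$ be a unital commutative ring and let $n, r$ be positive integers. For $w \in W_n$ (the symmetric group on $\{1,\dots,n\}$) let $P(w) = [\delta_{i,w(j)}]_{i,j=1}^n$ be its $n\times n$ permutation matrix over $\Bbbk$, and let $P(w)^{\otimes r}$ denote its $r$th Kronecker power, an $n^r \times n^r$ matrix. Let $\mathrm{im}(\Phi)$ denote the $\Bbbk$-linear span of $\{P(w)^{\otimes r} \mid w \in W_n\}$ inside the algebra of $n^r\times n^r$ matrices over $\Bbbk$. Then the set of all $P(w)^{\otimes r}$ such that $w \in W_n$ and the sequence $(w(1),w(2),\dots,w(n))$ has an increasing subsequence of length $n-r$ is a $\Bbbk$-basis of $\mathrm{im}(\Phi)$. Likewise, the set of all $P(w)^{\otimes r}$ such that $w\in W_n$ and $(w(1),\dots,w(n))$ has a decreasing subsequence of length $n-r$ is a $\Bbbk$-basis of $\mathrm{im}(\Phi)$.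
   Context: $\mathrm{im}(\Phi)$ is the image of the representation $\Phi:\Bbbk[W_n]\to \mathrm{End}_\Bbbk(V^{\otimes r})$, $\sum a_w w\mapsto \sum a_w P(w)^{\otimes r}$, where $V$ is free over $\Bbbk$ with basis $v_1,\dots,v_n$, $W_n$ acts by $w\cdot v_j=v_{w(j)}$, and acts diagonally on $V^{\otimes r}$; matrices are taken with respect to the basis $v_{i_1}\otimes\cdots\otimes v_{i_r}$. Integers are identified with their images in $\Bbbk$. A subsequence of length $\le 0$ is taken to exist trivially. -}

module Defs where

open import Level using (Level; _⊔_)
open import Algebra.Bundles using (CommutativeRing)
open import Data.Nat using (ℕ; zero; suc)
open import Data.Fin using (Fin; zero; suc; _<_; _≟_)
open import Data.Fin.Permutation using (Permutation′; _⟨$⟩ʳ_; _≈_)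
open import Data.Product using (Σ; _×_; _,_; proj₁; proj₂; ∃)
open import Data.List using (List; []; _∷_)
open import Data.List.Relation.Unary.All using (All)
open import Data.List.Relation.Unary.AllPairs using (AllPairs)
open import Relation.Nullary using (¬_; yes; no)

HasIncSubseq : {n : ℕ} → ℕ → Permutation′ n → Set
HasIncSubseq {n} m w =
  Σ (Fin m → Fin n) λ f →
    (∀ i j → i < j → f i < f j) × (∀ i j → i < j → (w ⟨$⟩ʳ f i) < (w ⟨$⟩ʳ f j))

HasDecSubseq : {n : ℕ} → ℕ → Permutation′ n → Set
HasDecSubseq {n} m w =
  Σ (Fin m → Fin n) λ f →
    (∀ i j → i < j → f i < f j) × (∀ i j → i < j → (w ⟨$⟩ʳ f j) < (w ⟨$⟩ʳ f i))

module Kron {c ℓ : Level} (K : CommutativeRing c ℓ) where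
  open CommutativeRing K using (_+_; _*_; 0#; 1#) renaming (Carrier to k; _≈_ to _≈k_)

  prodFin : (r : ℕ) → (Fin r → k) → k
  prodFin zero    g = 1#
  prodFin (suc r) g = g zero * prodFin r (λ i → g (suc i))

  -- n^r × n^r matrices, rows/columns indexed by multi-indices (i_1,...,i_r)
  Mat : ℕ → ℕ → Set c
  Mat n r = (Fin r → Fin n) → (Fin r → Fin n) → k

  P : {n : ℕ} → Permutation′ n → Fin n → Fin n → k
  P w i j with i ≟ (w ⟨$⟩ʳ j)
  ... | yes _ = 1#
  ... | no  _ = 0#

  KronPow : {n : ℕ} (r : ℕ) → Permutation′ n → Mat n r
  KronPow r w I J = prodFin r (λ t → P w (I t) (J t))

  zeroM : {n r : ℕ} → Mat n r
  zeroM _ _ = 0#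

  _≋_ : {n r : ℕ} → Mat n r → Mat n r → Set ℓ
  A ≋ B = ∀ I J → A I J ≈k B I J

  linComb : {n : ℕ} (r : ℕ) → List (k × Permutation′ n) → Mat n r
  linComb r []            I J = 0#
  linComb r ((a , w) ∷ L) I J = a * KronPow r w I J + linComb r L I J

  -- The family {P(w)^{⊗r} | Q w} is a k-basis of im(Φ) = span{P(w)^{⊗r} | w ∈ W_n}:
  --  * spanning: every element of im(Φ) is a linear combination of the family
  --    (the family elements themselves lie in im(Φ) by definition);
  --  * linear independence: a vanishing combination of pairwise distinct
  --    family members has all coefficients zero.
  IsBasisOfIm : (n r : ℕ) → (Permutation′ n → Set) → Set (c ⊔ ℓ)
  IsBasisOfIm n r Q =
    (∀ (L : List (k × Permutation′ n)) →
       ∃ λ (L′ : List (k × Permutation′ n)) →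
         All (λ p → Q (proj₂ p)) L′ × (linComb r L ≋ linComb r L′))
    ×
    (∀ (L : List (k × Permutation′ n)) →
       All (λ p → Q (proj₂ p)) L →
       AllPairs (λ p q → ¬ (proj₂ p ≈ proj₂ q)) L →
       linComb r L ≋ zeroM →
       All (λ p → proj₁ p ≈k 0#) L)

{-# OPTIONS --safe #-}
-- Entry (I , J) of P(w)^{⊗r} is 1 if w ∘ J = I and 0 otherwise.
--
-- Independence: if w is increasing outside r positions J, then w is the lexicographically
-- least permutation v with v ∘ J = w ∘ J, so the entries (w ∘ J , J) form a unitriangular system.
--
-- Spanning: if w has no increasing subsequence of length n - r, the positions split into
-- fewer than n - r blocks on which w decreases.  The alternating sum of P(w σ)^{⊗r} over the σ
-- preserving the blocks vanishes: any r positions miss two elements of one block, and their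
-- transposition cancels terms in pairs.  Every w σ with σ ≢ 1 is lexicographically smaller than w.
module Submission where

open import Defs
open import Level using (Level; _⊔_)
open import Algebra.Bundles using (CommutativeRing)
import Algebra.Properties.CommutativeMonoid.Sum as Sum
import Algebra.Properties.Ring as RingProperties
open import Data.Bool using (if_then_else_)
open import Data.Nat using (ℕ; zero; suc; _≤_; _∸_)
import Data.Nat as ℕ
import Data.Nat.Properties as ℕₚ
open import Data.Fin using (Fin; zero; suc; toℕ; fromℕ<; inject; punchIn; lift; combine; funToFin; join; splitAt; opposite; _<_; _>_; _≟_)
import Data.Fin.Properties as Finₚ
open import Data.Fin.Induction using (<-wellFounded; >-wellFounded)
open import Data.Fin.Permutation using (Permutation′; _⟨$⟩ʳ_; _⟨$⟩ˡ_; id; flip; insert; insert-punchIn; _∘ₚ_; inverseˡ; inverseʳ)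
  renaming (_≈_ to _≈ₚ_)
open import Data.List using (List; []; _∷_; _++_; map)
open import Data.List.Membership.Propositional using (_∈_)
open import Data.List.Relation.Unary.All as All using (All; []; _∷_)
import Data.List.Relation.Unary.All.Properties as Allₚ
open import Data.List.Relation.Unary.AllPairs using (AllPairs; _∷_)
open import Data.List.Relation.Unary.Any using (here; there)
open import Data.Product using (∃; ∃₂; _×_; _,_; proj₁; proj₂; map₂)
open import Data.Sum using (_⊎_; inj₁; inj₂)
open import Data.Sum.Properties using (inj₁-injective; inj₂-injective)
open import Data.Unit using (⊤; tt)
import Data.Vec.Functional as Vector
open import Function using (_∘_)
open import Function.Definitions using (Injective)
open import Induction.WellFounded using (Acc; acc)
open import Relation.Binary using (tri<; tri≈; tri>)
open import Relation.Binary.PropositionalEquality as ≡ using (_≡_; _≢_; _≗_)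
open import Relation.Nullary using (¬_; Dec; yes; no; does; contradiction; _×-dec_)
open import Relation.Nullary.Decidable using (dec-true; dec-false)

-- Increasing subsequences

IncSubseq : ∀ {n} → ℕ → (Fin n → Fin n) → Set
IncSubseq {n} m u =
  ∃ λ (f : Fin m → Fin n) → (∀ i j → i < j → f i < f j) × (∀ i j → i < j → u (f i) < u (f j))

strictMono⇒reflects : ∀ {m n} (f : Fin m → Fin n) → (∀ i j → i < j → f i < f j) →
  ∀ i j → f i < f j → i < j
strictMono⇒reflects f mono i j fi<fj with Finₚ.<-cmp i j
... | tri< i<j _ _ = i<j
... | tri≈ _ i≡j _ = contradiction (≡.cong f i≡j) (Finₚ.<⇒≢ fi<fj)
... | tri> _ _ i>j = contradiction (mono j i i>j) (Finₚ.<-asym fi<fj)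

strictMono⇒injective : ∀ {m n} (f : Fin m → Fin n) → (∀ i j → i < j → f i < f j) →
  Injective _≡_ _≡_ f
strictMono⇒injective f mono {i} {j} fi≡fj with Finₚ.<-cmp i j
... | tri< i<j _ _ = contradiction fi≡fj (Finₚ.<⇒≢ (mono i j i<j))
... | tri≈ _ i≡j _ = i≡j
... | tri> _ _ i>j = contradiction (≡.sym fi≡fj) (Finₚ.<⇒≢ (mono j i i>j))

module _ {n : ℕ} (u : Fin n → Fin n) where

  -- An increasing subsequence with `m` steps after position `i`; the recursive form makes it
  -- decidable by exhaustive search.
  Chain : ℕ → Fin n → Set
  Chain zero    i = ⊤
  Chain (suc m) i = ∃ λ j → (i < j × u i < u j) × Chain m j

  chain? : ∀ m i → Dec (Chain m i)
  chain? zero    i = yes tt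
  chain? (suc m) i =
    Finₚ.any? λ j → (i Finₚ.<? j ×-dec u i Finₚ.<? u j) ×-dec chain? m j

  -- The first position is recorded so that the induction can prepend `i`.
  chain⇒incSubseq : ∀ m i → Chain m i → ∃ λ (s : IncSubseq (suc m) u) → proj₁ s zero ≡ i
  chain⇒incSubseq zero i _ = ((λ _ → i) , (λ { zero zero () }) , (λ { zero zero () })) , ≡.refl
  chain⇒incSubseq (suc m) i (j , (i<j , ui<uj) , c)
    with (f , mono , inc) , ≡.refl ← chain⇒incSubseq m j c =
    (i Vector.∷ f , mono′ , inc′) , ≡.refl
    where
    mono′ : ∀ a b → a < b → (i Vector.∷ f) a < (i Vector.∷ f) b
    mono′ zero (suc zero) _ = i<j
    mono′ zero (suc (suc b)) _ = Finₚ.<-trans i<j (mono zero (suc b) ℕ.z<s)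
    mono′ (suc a) (suc b) (ℕ.s≤s a<b) = mono a b a<b
    inc′ : ∀ a b → a < b → u ((i Vector.∷ f) a) < u ((i Vector.∷ f) b)
    inc′ zero (suc zero) _ = ui<uj
    inc′ zero (suc (suc b)) _ = Finₚ.<-trans ui<uj (inc zero (suc b) ℕ.z<s)
    inc′ (suc a) (suc b) (ℕ.s≤s a<b) = inc a b a<b

  -- The colour of i is the largest l < m such that a chain with l steps starts at i.
  colour : ℕ → Fin n → ℕ
  colour zero    i = zero
  colour (suc m) i with chain? m i
  ... | yes _ = m
  ... | no  _ = colour m i

  colour< : ∀ m i → ¬ Chain m i → colour m i ℕ.< m
  colour< zero    i ¬c = contradiction tt ¬c
  colour< (suc m) i ¬c with chain? m i
  ... | yes _  = ℕₚ.n<1+n m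
  ... | no ¬c′ = ℕₚ.m<n⇒m<1+n (colour< m i ¬c′)

  -- Prepending `i` to a chain from `j` gives a chain with one more step, so the longest chain from
  -- `i` is strictly longer than that from `j`.
  colour-separates : ∀ m {i j} → ¬ Chain m i → ¬ Chain m j → i < j → u i < u j →
    colour m i ≢ colour m j
  colour-separates zero    ¬ci _ _ _ _ = contradiction tt ¬ci
  colour-separates (suc m) {i} {j} ¬ci ¬cj i<j ui<uj eq with chain? m i | chain? m j
  ... | _      | yes cj = contradiction (j , (i<j , ui<uj) , cj) ¬ci
  ... | yes _  | no ¬c  = contradiction (≡.sym eq) (ℕₚ.<⇒≢ (colour< m j ¬c))
  ... | no ¬c  | no ¬c′ = colour-separates m ¬c ¬c′ i<j ui<uj eq

  -- Mirsky's argument: if no chain has `m` steps, all colours lie below `m`, and two positions of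
  -- one colour cannot be in ascending order.
  incSubseq-or-colouring : Injective _≡_ _≡_ u → ∀ m →
    IncSubseq (suc m) u ⊎
    ∃ λ (b : Fin n → Fin m) → ∀ i j → i < j → b i ≡ b j → u j < u i
  incSubseq-or-colouring inj m with Finₚ.any? (chain? m)
  ... | yes (i , c) = inj₁ (proj₁ (chain⇒incSubseq m i c))
  ... | no ¬∃c = inj₂ (b , b-dec)
    where
    ¬c : ∀ i → ¬ Chain m i
    ¬c i c = ¬∃c (i , c)
    b : Fin n → Fin m
    b i = fromℕ< (colour< m i (¬c i))
    b-dec : ∀ i j → i < j → b i ≡ b j → u j < u i
    b-dec i j i<j bi≡bj with Finₚ.<-cmp (u i) (u j)
    ... | tri> _ _ uj<ui = uj<ui
    ... | tri≈ _ ui≡uj _ = contradiction (inj ui≡uj) (Finₚ.<⇒≢ i<j)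
    ... | tri< ui<uj _ _ = contradiction
      (Finₚ.fromℕ<-injective _ _ (colour< m i (¬c i)) (colour< m j (¬c j)) bi≡bj)
      (colour-separates m (¬c i) (¬c j) i<j ui<uj)

-- Covering positions and the pigeonhole principle

∷-injective : ∀ {m n} {f : Fin m → Fin n} {x} → Injective _≡_ _≡_ f → (∀ i → f i ≢ x) →
  Injective _≡_ _≡_ (x Vector.∷ f)
∷-injective inj x∉f {zero}  {zero}  _  = ≡.refl
∷-injective inj x∉f {zero}  {suc j} eq = contradiction (≡.sym eq) (x∉f j)
∷-injective inj x∉f {suc i} {zero}  eq = contradiction eq (x∉f i)
∷-injective inj x∉f {suc i} {suc j} eq = ≡.cong suc (inj eq)

-- Induction on `r`: a point missed by `f` is adjoined to both `f` and `J`. Once nothing is missed,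
-- `pad` fills the remaining slots of `J`.
cover-complement : ∀ r {m n} (f : Fin m → Fin n) → Fin n → Injective _≡_ _≡_ f → n ≤ m ℕ.+ r →
  ∃ λ (J : Fin r → Fin n) → ∀ x → (∃ λ i → f i ≡ x) ⊎ (∃ λ t → J t ≡ x)
cover-complement r {m} {n} f pad inj n≤m+r with Finₚ.all? (λ x → Finₚ.any? (λ i → f i ≟ x))
... | yes surj = (λ _ → pad) , λ x → inj₁ (surj x)
... | no ¬surj with r | Finₚ.¬∀⟶∃¬ n _ (λ x → Finₚ.any? (λ i → f i ≟ x)) ¬surj
...   | zero  | x , x∉f = contradiction
        (ℕₚ.≤-trans (Finₚ.injective⇒≤ (∷-injective inj λ i eq → x∉f (i , eq)))
          (≡.subst (n ≤_) (ℕₚ.+-identityʳ m) n≤m+r))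
        ℕₚ.1+n≰n
...   | suc r′ | x , x∉f
        with cover-complement r′ (x Vector.∷ f) pad (∷-injective inj λ i eq → x∉f (i , eq))
               (≡.subst (n ≤_) (ℕₚ.+-suc m r′) n≤m+r)
...     | J , covers = x Vector.∷ J , covers′
  where
  covers′ : ∀ y → (∃ λ i → f i ≡ y) ⊎ (∃ λ t → (x Vector.∷ J) t ≡ y)
  covers′ y with covers y
  ... | inj₁ (zero  , eq) = inj₂ (zero , eq)
  ... | inj₁ (suc i , eq) = inj₁ (i , eq)
  ... | inj₂ (t , eq)     = inj₂ (suc t , eq)

-- Label a position by an index at which `J` hits it, or else by its block. Two positions share one
-- of the `m + r` labels; it must be a block, since an index of `J` determines the position.
uncovered-monochromatic-pair : ∀ {m n r} (b : Fin n → Fin m) (J : Fin r → Fin n) → m ℕ.+ r ℕ.< n →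
  ∃₂ λ p q → p < q × b p ≡ b q × (∀ t → J t ≢ p) × (∀ t → J t ≢ q)
uncovered-monochromatic-pair {m} {n} {r} b J m+r<n =
  let p , q , p<q , eq = Finₚ.pigeonhole m+r<n (join m r ∘ label)
  in p , q , p<q , analyse p<q (join-injective eq)
  where
  join-injective : ∀ {x y} → join m r x ≡ join m r y → x ≡ y
  join-injective {x} {y} eq = ≡.trans (≡.sym (Finₚ.splitAt-join m r x))
    (≡.trans (≡.cong (splitAt m) eq) (Finₚ.splitAt-join m r y))
  label : Fin n → Fin m ⊎ Fin r
  label x with Finₚ.any? (λ t → J t ≟ x)
  ... | yes (t , _) = inj₂ t
  ... | no  _       = inj₁ (b x)
  analyse : ∀ {p q} → p < q → label p ≡ label q →
    b p ≡ b q × (∀ t → J t ≢ p) × (∀ t → J t ≢ q)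
  analyse {p} {q} p<q eq with Finₚ.any? (λ t → J t ≟ p) | Finₚ.any? (λ t → J t ≟ q)
  ... | yes (t , Jt≡p) | yes (_ , Jt≡q) with ≡.refl ← inj₂-injective eq =
    contradiction (≡.trans (≡.sym Jt≡p) Jt≡q) (Finₚ.<⇒≢ p<q)
  ... | no p∉J | no q∉J = inj₁-injective eq , (λ t e → p∉J (t , e)) , (λ t e → q∉J (t , e))

-- The lexicographic order on functions, encoded by funToFin

combine-monoʳ-< : ∀ {m n} (i : Fin m) {k l : Fin n} → k < l → combine i k < combine i l
combine-monoʳ-< {m} {n} i {k} {l} k<l =
  ≡.subst₂ ℕ._<_ (≡.sym (Finₚ.toℕ-combine i k)) (≡.sym (Finₚ.toℕ-combine i l))
    (ℕₚ.+-monoʳ-< (n ℕ.* toℕ i) k<l)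

-- `funToFin` reads the values as digits, the value at `zero` being the most significant, so the
-- first difference decides.
funToFin-lex : ∀ {m n} {f g : Fin m → Fin n} j → (∀ i → i < j → f i ≡ g i) → f j < g j →
  funToFin f < funToFin g
funToFin-lex zero _ f0<g0 = Finₚ.combine-monoˡ-< _ _ f0<g0
funToFin-lex {f = f} {g} (suc j) agree fj<gj rewrite agree zero ℕ.z<s =
  combine-monoʳ-< (g zero) (funToFin-lex j (λ i i<j → agree (suc i) (ℕ.s<s i<j)) fj<gj)

funToFin-cong : ∀ {m n} {f g : Fin m → Fin n} → f ≗ g → funToFin f ≡ funToFin g
funToFin-cong {zero}  f≗g = ≡.refl
funToFin-cong {suc m} f≗g = ≡.cong₂ combine (f≗g zero) (funToFin-cong (f≗g ∘ suc))

permute-injective : ∀ {n} (w : Permutation′ n) → Injective _≡_ _≡_ (w ⟨$⟩ʳ_)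
permute-injective w eq = ≡.trans (≡.sym (inverseˡ w)) (≡.trans (≡.cong (w ⟨$⟩ˡ_) eq) (inverseˡ w))

Moves : ∀ {n} → Permutation′ n → Set
Moves σ = ∃ λ j → σ ⟨$⟩ʳ j ≢ j

-- If the smallest moved point `j` had its image below `j`, that image would be fixed, and
-- injectivity would make `j` fixed too.
first-moved : ∀ {n} (σ : Permutation′ n) → Moves σ →
  ∃ λ j → (∀ i → i < j → σ ⟨$⟩ʳ i ≡ i) × j < σ ⟨$⟩ʳ j
first-moved {n} σ (k , σk≢k)
  with j , σj≢j , fixed′ ← Finₚ.¬∀⟶∃¬-smallest n (λ i → σ ⟨$⟩ʳ i ≡ i) (λ i → σ ⟨$⟩ʳ i ≟ i) (λ σ≈id → σk≢k (σ≈id k))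
  = j , fixed , j<σj
  where
  fixed : ∀ i → i < j → σ ⟨$⟩ʳ i ≡ i
  fixed i i<j = ≡.subst (λ x → σ ⟨$⟩ʳ x ≡ x)
    (Finₚ.toℕ-injective (≡.trans (Finₚ.toℕ-inject (fromℕ< i<j)) (Finₚ.toℕ-fromℕ< i<j)))
    (fixed′ (fromℕ< i<j))
  j<σj : j < σ ⟨$⟩ʳ j
  j<σj with Finₚ.<-cmp j (σ ⟨$⟩ʳ j)
  ... | tri< j<σj _ _ = j<σj
  ... | tri≈ _ j≡σj _ = contradiction (≡.sym j≡σj) σj≢j
  ... | tri> _ _ σj<j = contradiction (permute-injective σ (fixed _ σj<j)) σj≢j

-- The first moved `j` goes to a later position of its own block, where `u` is smaller.
lex-decrease : ∀ {m n} (u : Fin n → Fin n) (b : Fin n → Fin m) →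
  (∀ i j → i < j → b i ≡ b j → u j < u i) →
  (σ : Permutation′ n) → Moves σ → (∀ j → b j ≡ b (σ ⟨$⟩ʳ j)) →
  funToFin (u ∘ (σ ⟨$⟩ʳ_)) < funToFin u
lex-decrease u b dec σ moves pres with j , fixed , j<σj ← first-moved σ moves =
  funToFin-lex j (λ i i<j → ≡.cong u (fixed i i<j)) (dec _ _ j<σj (pres j))

-- The first moved `j` and its image both lie outside `J`, whose entries are fixed. Hence both lie
-- on the increasing subsequence, and moving right raises `u`.
lex-increase : ∀ {m n r} (u : Fin n → Fin n) ((f , _) : IncSubseq m u) (J : Fin r → Fin n) →
  (∀ x → (∃ λ i → f i ≡ x) ⊎ (∃ λ t → J t ≡ x)) →
  (σ : Permutation′ n) → Moves σ → (∀ t → σ ⟨$⟩ʳ J t ≡ J t) →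
  funToFin u < funToFin (u ∘ (σ ⟨$⟩ʳ_))
lex-increase u (f , mono , inc) J covers σ moves fixesJ with first-moved σ moves
... | j , fixed , j<σj with covers j | covers (σ ⟨$⟩ʳ j)
...   | inj₂ (t , ≡.refl) | _ = contradiction (≡.sym (fixesJ t)) (Finₚ.<⇒≢ j<σj)
...   | inj₁ _ | inj₂ (t , Jt≡σj) = contradiction
        (≡.sym (permute-injective σ (≡.subst (λ x → σ ⟨$⟩ʳ x ≡ x) Jt≡σj (fixesJ t))))
        (Finₚ.<⇒≢ j<σj)
...   | inj₁ (i , fi≡j) | inj₁ (i′ , fi′≡σj) =
        funToFin-lex j (λ i i<j → ≡.sym (≡.cong u (fixed i i<j)))
          (≡.subst₂ (λ x y → u x < u y) fi≡j fi′≡σj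
            (inc i i′ (strictMono⇒reflects f mono i i′
              (≡.subst₂ _<_ (≡.sym fi≡j) (≡.sym fi′≡σj) j<σj))))

module _ {c ℓ : Level} (K : CommutativeRing c ℓ) where
  open CommutativeRing K renaming (Carrier to k) hiding (zero)
  open RingProperties ring using (-0#≈0#; -‿+-comm; -‿distribʳ-*; -1*x≈-x)
  open Sum *-commutativeMonoid using () renaming
    (sum to ∏; sum-cong-≋ to ∏-cong; ∑-distrib-+ to ∏-distrib-*; ∑-comm to ∏-comm; sum-replicate-zero to ∏-replicate-1)
  open import Relation.Binary.Reasoning.Setoid setoid
  open Kron K
  open import Algebra.Properties.CommutativeSemigroup +-commutativeSemigroup
    using () renaming (interchange to +-interchange)
  open import Algebra.Properties.CommutativeSemigroup *-commutativeSemigroup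
    using () renaming (x∙yz≈y∙xz to x*yz≈y*xz)

  -- Alternating sums and determinants

  opaque
    altΣ : ∀ {n} → (Fin n → k) → k
    altΣ {zero}  f = 0#
    altΣ {suc n} f = f zero - altΣ (f ∘ suc)

    altΣ-cong : ∀ {n} {f g : Fin n → k} → (∀ i → f i ≈ g i) → altΣ f ≈ altΣ g
    altΣ-cong {zero}  f≈g = refl
    altΣ-cong {suc n} f≈g = +-cong (f≈g zero) (-‿cong (altΣ-cong (f≈g ∘ suc)))

    altΣ-0 : ∀ {n} {f : Fin n → k} → (∀ i → f i ≈ 0#) → altΣ f ≈ 0#
    altΣ-0 {zero}  f≈0 = refl
    altΣ-0 {suc n} f≈0 =
      trans (+-cong (f≈0 zero) (trans (-‿cong (altΣ-0 (f≈0 ∘ suc))) -0#≈0#)) (+-identityʳ 0#)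

    altΣ-+ : ∀ {n} (f g : Fin n → k) → altΣ f + altΣ g ≈ altΣ (λ i → f i + g i)
    altΣ-+ {zero}  f g = +-identityʳ 0#
    altΣ-+ {suc n} f g = begin
      (f zero - altΣ (f ∘ suc)) + (g zero - altΣ (g ∘ suc))
        ≈⟨ +-interchange _ _ _ _ ⟩
      (f zero + g zero) + (- altΣ (f ∘ suc) + - altΣ (g ∘ suc))
        ≈⟨ +-congˡ (-‿+-comm _ _) ⟩
      (f zero + g zero) - (altΣ (f ∘ suc) + altΣ (g ∘ suc))
        ≈⟨ +-congˡ (-‿cong (altΣ-+ (f ∘ suc) (g ∘ suc))) ⟩
      (f zero + g zero) - altΣ (λ i → f (suc i) + g (suc i)) ∎

    *-altΣ : ∀ {n} a (f : Fin n → k) → a * altΣ f ≈ altΣ (λ i → a * f i)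
    *-altΣ {zero}  a f = zeroʳ a
    *-altΣ {suc n} a f = begin
      a * (f zero - altΣ (f ∘ suc))          ≈⟨ distribˡ a _ _ ⟩
      a * f zero + a * - altΣ (f ∘ suc)      ≈⟨ +-congˡ (-‿distribʳ-* a _) ⟨
      a * f zero - a * altΣ (f ∘ suc)        ≈⟨ +-congˡ (-‿cong (*-altΣ a (f ∘ suc))) ⟩
      a * f zero - altΣ (λ i → a * f (suc i)) ∎

    altΣ-suc : ∀ {n} (f : Fin (suc n) → k) → altΣ f ≈ f zero - altΣ (f ∘ suc)
    altΣ-suc f = refl

  x-y+y≈x : ∀ x y → (x - y) + y ≈ x
  x-y+y≈x x y = trans (+-assoc x (- y) y) (trans (+-congˡ (-‿inverseˡ y)) (+-identityʳ x))

  -- The pairs (i , punchIn i j) run through all x ≢ y, and exchanging x and y flips the sign.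
  altΣ₂-symmetric : ∀ {n} (E : Fin (suc (suc n)) → Fin (suc (suc n)) → (Fin n → Fin (suc (suc n))) → k) →
    (∀ x y g → E x y g ≈ E y x g) →
    (∀ x y {g h} → g ≗ h → E x y g ≈ E x y h) →
    altΣ (λ i → altΣ (λ j → E i (punchIn i j) (punchIn i ∘ punchIn j))) ≈ 0#
  -- These are the pairs avoiding `zero`. Shifting indices down reduces the sum to `altΣ₂-symmetric`
  -- one size smaller, where `lift 1` puts `zero` back among the remaining indices.
  altΣ₂-symmetric-suc : ∀ {n} (E : Fin (suc (suc n)) → Fin (suc (suc n)) → (Fin n → Fin (suc (suc n))) → k) →
    (∀ x y g → E x y g ≈ E y x g) →
    (∀ x y {g h} → g ≗ h → E x y g ≈ E x y h) →
    altΣ (λ i → altΣ (λ j → E (suc i) (suc (punchIn i j)) (punchIn (suc i) ∘ punchIn (suc j)))) ≈ 0#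

  altΣ₂-symmetric E E-sym E-ext = begin
    altΣ (λ i → altΣ (λ j → E i (punchIn i j) (punchIn i ∘ punchIn j)))
      ≈⟨ altΣ-suc _ ⟩
    altΣ row - altΣ (λ i → altΣ (λ j → E (suc i) (punchIn (suc i) j) (punchIn (suc i) ∘ punchIn j)))
      ≈⟨ +-congˡ (-‿cong (altΣ-cong λ i → altΣ-suc _)) ⟩
    altΣ row - altΣ (λ i → col i - rest i)
      ≈⟨ +-congˡ (-‿cong (trans (sym (+-identityʳ _)) (+-congˡ (sym (altΣ₂-symmetric-suc E E-sym E-ext))))) ⟩
    altΣ row - (altΣ (λ i → col i - rest i) + altΣ rest)
      ≈⟨ +-congˡ (-‿cong (altΣ-+ _ rest)) ⟩
    altΣ row - altΣ (λ i → (col i - rest i) + rest i)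
      ≈⟨ +-congˡ (-‿cong (altΣ-cong λ i → trans (x-y+y≈x _ _) (E-sym _ _ _))) ⟩
    altΣ row - altΣ row
      ≈⟨ -‿inverseʳ _ ⟩
    0# ∎
    where
    -- The pairs with `x` zero, with `y` zero, and with neither. The sum of `rest` vanishes by the
    -- mutual induction, so it can be added to cancel `rest`; symmetry then identifies `col` with
    -- `row`.
    row = λ j → E zero (suc j) (λ l → suc (punchIn j l))
    col = λ i → E (suc i) zero (λ l → suc (punchIn i l))
    rest = λ i → altΣ (λ j → E (suc i) (suc (punchIn i j)) (punchIn (suc i) ∘ punchIn (suc j)))

  altΣ₂-symmetric-suc {zero}  E E-sym E-ext = altΣ-0 λ i → altΣ-0 λ ()
  altΣ₂-symmetric-suc {suc n} E E-sym E-ext = trans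
    (altΣ-cong λ i → altΣ-cong λ j → E-ext _ _ λ { zero → ≡.refl ; (suc l) → ≡.refl })
    (altΣ₂-symmetric (λ x y g → E (suc x) (suc y) (lift 1 g))
      (λ x y g → E-sym _ _ _)
      (λ x y g≗h → E-ext _ _ λ { zero → ≡.refl ; (suc l) → ≡.cong suc (g≗h l) }))

  opaque
    -- Column j of A is A j.
    det : ∀ {n} → (Fin n → Fin n → k) → k
    det {zero}  A = 1#
    det {suc n} A = altΣ λ i → A zero i * det (λ j x → A (suc j) (punchIn i x))

    det-suc : ∀ {n} (A : Fin (suc n) → Fin (suc n) → k) →
      det A ≈ altΣ (λ i → A zero i * det (λ j x → A (suc j) (punchIn i x)))
    det-suc A = refl

    det-cong : ∀ {n} {A B : Fin n → Fin n → k} → (∀ j x → A j x ≈ B j x) → det A ≈ det B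
    det-cong {zero}  A≈B = refl
    det-cong {suc n} A≈B =
      altΣ-cong λ i → *-cong (A≈B zero i) (det-cong λ j x → A≈B (suc j) (punchIn i x))

  module _ {n : ℕ} (B : Fin n → Fin (suc (suc n)) → k) where

    -- The term of the Laplace expansion along the first two columns that picks rows `x` and `y`;
    -- `g` enumerates the remaining rows.
    expand₂ : (c d : Fin (suc (suc n)) → k) (x y : Fin (suc (suc n))) → (Fin n → Fin (suc (suc n))) → k
    expand₂ c d x y g = c x * (d y * det (λ j l → B j (g l)))

    expand₂-ext : ∀ c d x y {g h} → g ≗ h → expand₂ c d x y g ≈ expand₂ c d x y h
    expand₂-ext c d x y g≗h =
      *-congˡ (*-congˡ (det-cong λ j l → reflexive (≡.cong (B j) (g≗h l))))

    det-expand₂ : ∀ c d → det (c Vector.∷ d Vector.∷ B) ≈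
      altΣ (λ i → altΣ (λ j → expand₂ c d i (punchIn i j) (punchIn i ∘ punchIn j)))
    det-expand₂ c d = trans (det-suc _) (altΣ-cong λ i →
      trans (*-congˡ (det-suc _)) (*-altΣ (c i) _))

    det-swap : ∀ c d → det (c Vector.∷ d Vector.∷ B) + det (d Vector.∷ c Vector.∷ B) ≈ 0#
    det-swap c d = begin
      det (c Vector.∷ d Vector.∷ B) + det (d Vector.∷ c Vector.∷ B)
        ≈⟨ +-cong (det-expand₂ c d) (det-expand₂ d c) ⟩
      _ ≈⟨ altΣ-+ {suc (suc n)} _ _ ⟩
      _ ≈⟨ altΣ-cong {suc (suc n)} (λ i → altΣ-+ {suc n} _ _) ⟩
      _ ≈⟨ altΣ₂-symmetric (λ x y g → expand₂ c d x y g + expand₂ d c x y g)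
             (λ x y g → trans (+-comm _ _) (+-cong (x*yz≈y*xz _ _ _) (x*yz≈y*xz _ _ _)))
             (λ x y g≗h → +-cong (expand₂-ext c d x y g≗h) (expand₂-ext d c x y g≗h)) ⟩
      0# ∎

    -- `det-swap` would only show that twice the determinant vanishes, which is too weak in
    -- characteristic 2; the symmetry of the expansion itself is used instead.
    det-repeat : ∀ c → det (c Vector.∷ c Vector.∷ B) ≈ 0#
    det-repeat c = trans (det-expand₂ c c)
      (altΣ₂-symmetric (expand₂ c c) (λ x y g → x*yz≈y*xz _ _ _) (expand₂-ext c c))

  det-equal-columns : ∀ {n} (A : Fin n → Fin n → k) p q → p < q → (∀ x → A p x ≈ A q x) → det A ≈ 0#
  det-equal-columns {suc n} A (suc p) (suc q) (ℕ.s≤s p<q) Ap≈Aq = trans (det-suc A) (altΣ-0 λ i →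
    trans (*-congˡ (det-equal-columns _ p q p<q λ x → Ap≈Aq (punchIn i x))) (zeroʳ _))
  det-equal-columns {suc (suc n)} A zero (suc zero) _ A₀≈A₁ = trans
    (det-cong λ { zero x → refl ; (suc zero) x → sym (A₀≈A₁ x) ; (suc (suc j)) x → refl })
    (det-repeat (λ j → A (suc (suc j))) (A zero))
  det-equal-columns {suc (suc n)} A zero (suc (suc q)) _ A₀≈Aq = begin
    det A                    ≈⟨ det-cong (λ { zero x → refl ; (suc zero) x → refl ; (suc (suc j)) x → refl }) ⟩
    det (A zero Vector.∷ A (suc zero) Vector.∷ B)
      ≈⟨ +-identityʳ _ ⟨
    det (A zero Vector.∷ A (suc zero) Vector.∷ B) + 0#
      -- After the first two columns are swapped, the equal columns both survive into every minor,
      -- so the swapped determinant vanishes by induction.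
      ≈⟨ +-congˡ (trans (det-suc _) (altΣ-0 λ i →
           trans (*-congˡ (det-equal-columns _ zero (suc q) ℕ.z<s λ x → A₀≈Aq (punchIn i x))) (zeroʳ _))) ⟨
    det (A zero Vector.∷ A (suc zero) Vector.∷ B) + det (A (suc zero) Vector.∷ A zero Vector.∷ B)
      ≈⟨ det-swap B _ _ ⟩
    0# ∎
    where B = λ j → A (suc (suc j))

  -- Signed sums over permutations and Leibniz' formula

  opaque
    unfolding det

    -- Inserting 0 ↦ i multiplies the sign of σ by (-1)^i, so this is the signed sum over all permutations.
    alt : ∀ {n} → (Permutation′ n → k) → k
    alt {zero}  F = F id
    alt {suc n} F = altΣ λ i → alt λ σ → F (insert zero i σ)

    alt-cong : ∀ {n} {F G : Permutation′ n → k} → (∀ σ → F σ ≈ G σ) → alt F ≈ alt G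
    alt-cong {zero}  F≈G = F≈G id
    alt-cong {suc n} F≈G = altΣ-cong λ i → alt-cong λ σ → F≈G (insert zero i σ)

    *-alt : ∀ {n} a (F : Permutation′ n → k) → a * alt F ≈ alt (λ σ → a * F σ)
    *-alt {zero}  a F = refl
    *-alt {suc n} a F = trans (*-altΣ a _) (altΣ-cong λ i → *-alt a (λ σ → F (insert zero i σ)))

    -- The recursion of `alt` on the image of `zero` is the Laplace expansion along the first
    -- column.
    leibniz : ∀ {n} (A : Fin n → Fin n → k) → alt (λ σ → ∏ (λ j → A j (σ ⟨$⟩ʳ j))) ≈ det A
    leibniz {zero}  A = refl
    leibniz {suc n} A = altΣ-cong λ i → begin
      alt (λ σ → A zero i * ∏ (λ j → A (suc j) (insert zero i σ ⟨$⟩ʳ suc j)))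
        ≈⟨ alt-cong (λ σ → *-congˡ (∏-cong λ j → reflexive (≡.cong (A (suc j)) (insert-punchIn zero i σ j)))) ⟩
      alt (λ σ → A zero i * ∏ (λ j → A (suc j) (punchIn i (σ ⟨$⟩ʳ j))))
        ≈⟨ *-alt (A zero i) (λ σ → ∏ (λ j → A (suc j) (punchIn i (σ ⟨$⟩ʳ j)))) ⟨
      A zero i * alt (λ σ → ∏ (λ j → A (suc j) (punchIn i (σ ⟨$⟩ʳ j))))
        ≈⟨ *-congˡ (leibniz λ j x → A (suc j) (punchIn i x)) ⟩
      A zero i * det (λ j x → A (suc j) (punchIn i x)) ∎

  -- Kronecker powers as products of Kronecker deltas

  δ : ∀ {n} → Fin n → Fin n → k
  δ i j = if does (i ≟ j) then 1# else 0#

  δ-refl : ∀ {n} {i j : Fin n} → i ≡ j → δ i j ≈ 1#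
  δ-refl {i = i} {j} i≡j rewrite dec-true (i ≟ j) i≡j = refl

  δ-≢ : ∀ {n} {i j : Fin n} → i ≢ j → δ i j ≈ 0#
  δ-≢ {i = i} {j} i≢j rewrite dec-false (i ≟ j) i≢j = refl

  P≈δ : ∀ {n} (w : Permutation′ n) i j → P w i j ≈ δ i (w ⟨$⟩ʳ j)
  P≈δ w i j with i ≟ (w ⟨$⟩ʳ j)
  ... | yes _ = refl
  ... | no  _ = refl

  prodFin≈∏ : ∀ r (g : Fin r → k) → prodFin r g ≈ ∏ g
  prodFin≈∏ zero    g = refl
  prodFin≈∏ (suc r) g = *-congˡ (prodFin≈∏ r (g ∘ suc))

  ∏-1 : ∀ {n} {g : Fin n → k} → (∀ i → g i ≈ 1#) → ∏ g ≈ 1#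
  ∏-1 {n} g≈1 = trans (∏-cong g≈1) (∏-replicate-1 n)

  ∏-0 : ∀ {n} {g : Fin n → k} i → g i ≈ 0# → ∏ g ≈ 0#
  ∏-0 zero    g₀≈0 = trans (*-congʳ g₀≈0) (zeroˡ _)
  ∏-0 {g = g} (suc i) gᵢ≈0 = trans (*-congˡ (∏-0 {g = g ∘ suc} i gᵢ≈0)) (zeroʳ _)

  ∏-select : ∀ {n} i (F : Fin n → k) → ∏ (λ j → if does (i ≟ j) then F j else 1#) ≈ F i
  ∏-select {suc n} zero F = trans (*-congˡ (∏-replicate-1 n)) (*-identityʳ _)
  ∏-select (suc i) F = trans (*-identityˡ _) (∏-select i (F ∘ suc))

  module _ {n r : ℕ} where

    KronPow-∏ : ∀ (w : Permutation′ n) I J → KronPow r w I J ≈ ∏ (λ t → δ (I t) (w ⟨$⟩ʳ J t))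
    KronPow-∏ w I J = trans (prodFin≈∏ r _) (∏-cong λ t → P≈δ w (I t) (J t))

    KronPow-cong : ∀ {v w : Permutation′ n} → v ≈ₚ w → KronPow r v ≋ KronPow r w
    KronPow-cong {v} {w} v≈w I J = trans (KronPow-∏ v I J)
      (trans (∏-cong λ t → reflexive (≡.cong (δ (I t)) (v≈w (J t)))) (sym (KronPow-∏ w I J)))

    KronPow-1 : ∀ (w : Permutation′ n) I J → (∀ t → I t ≡ w ⟨$⟩ʳ J t) → KronPow r w I J ≈ 1#
    KronPow-1 w I J eq = trans (KronPow-∏ w I J) (∏-1 (δ-refl ∘ eq))

    KronPow-0 : ∀ (w : Permutation′ n) I J t → I t ≢ w ⟨$⟩ʳ J t → KronPow r w I J ≈ 0#
    KronPow-0 w I J t neq = trans (KronPow-∏ w I J) (∏-0 t (δ-≢ neq))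

    -- The indicator of the permutations preserving every block; as a product over positions it can
    -- be absorbed into matrix entries.
    blockδ : ∀ {m} → (Fin n → Fin m) → Permutation′ n → k
    blockδ b σ = ∏ λ j → δ (b j) (b (σ ⟨$⟩ʳ j))

    -- Leibniz' formula turns the sum into a determinant, and any two elements of a block
    -- outside the image of J give equal columns.
    alt-blocks-vanishes : ∀ {m} (b : Fin n → Fin m) → m ℕ.+ r ℕ.< n → (w : Permutation′ n) → ∀ I J →
      alt (λ σ → blockδ b σ * KronPow r (σ ∘ₚ w) I J) ≈ 0#
    alt-blocks-vanishes b m+r<n w I J = begin
      alt (λ σ → blockδ b σ * KronPow r (σ ∘ₚ w) I J) ≈⟨ alt-cong as-product ⟩
      alt (λ σ → ∏ (λ j → A j (σ ⟨$⟩ʳ j)))            ≈⟨ leibniz A ⟩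
      det A                                           ≈⟨ equal-columns ⟩
      0#                                              ∎
      where
      -- Each factor of the Kronecker power is spread over all positions `j`, with value 1 away from
      -- `J t`; exchanging the two products then gives a product over `j`.
      entry : Fin n → Fin r → Fin n → k
      entry j t x = if does (J t ≟ j) then δ (I t) (w ⟨$⟩ʳ x) else 1#
      A : Fin n → Fin n → k
      A j x = δ (b j) (b x) * ∏ (λ t → entry j t x)
      as-product : ∀ σ → blockδ b σ * KronPow r (σ ∘ₚ w) I J ≈ ∏ (λ j → A j (σ ⟨$⟩ʳ j))
      as-product σ = begin
        blockδ b σ * KronPow r (σ ∘ₚ w) I J
          ≈⟨ *-congˡ (KronPow-∏ (σ ∘ₚ w) I J) ⟩
        blockδ b σ * ∏ (λ t → δ (I t) (w ⟨$⟩ʳ (σ ⟨$⟩ʳ J t)))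
          ≈⟨ *-congˡ (∏-cong λ t → ∏-select (J t) (λ j → δ (I t) (w ⟨$⟩ʳ (σ ⟨$⟩ʳ j)))) ⟨
        blockδ b σ * ∏ (λ t → ∏ (λ j → entry j t (σ ⟨$⟩ʳ j)))
          ≈⟨ *-congˡ (∏-comm λ t j → entry j t (σ ⟨$⟩ʳ j)) ⟩
        blockδ b σ * ∏ (λ j → ∏ (λ t → entry j t (σ ⟨$⟩ʳ j)))
          ≈⟨ ∏-distrib-* (λ j → δ (b j) (b (σ ⟨$⟩ʳ j))) _ ⟨
        ∏ (λ j → A j (σ ⟨$⟩ʳ j)) ∎
      uncovered : ∀ {p} x → (∀ t → J t ≢ p) → ∏ (λ t → entry p t x) ≈ 1#
      uncovered {p} x p∉J = ∏-1 λ t → reflexive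
        (≡.cong (λ d → if d then δ (I t) (w ⟨$⟩ʳ x) else 1#) (dec-false (J t ≟ p) (p∉J t)))
      equal-columns : det A ≈ 0#
      equal-columns with p , q , p<q , bp≡bq , p∉J , q∉J ← uncovered-monochromatic-pair b J m+r<n =
        det-equal-columns A p q p<q λ x → *-cong
          (reflexive (≡.cong (λ y → δ y (b x)) bp≡bq))
          (trans (uncovered x p∉J) (sym (uncovered x q∉J)))

    -- Linear spans of Kronecker powers

    module _ (Q : Permutation′ n → Set) where

      InSpan : Mat n r → Set (c ⊔ ℓ)
      InSpan X = ∃ λ (L : List (k × Permutation′ n)) → All (Q ∘ proj₂) L × (X ≋ linComb r L)

    linComb-++ : ∀ L M I J → linComb {n} r (L ++ M) I J ≈ linComb r L I J + linComb r M I J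
    linComb-++ []            M I J = sym (+-identityˡ _)
    linComb-++ ((a , w) ∷ L) M I J = trans (+-congˡ (linComb-++ L M I J)) (sym (+-assoc _ _ _))

    linComb-scale : ∀ a L I J →
      linComb {n} r (map (λ (b , w) → a * b , w) L) I J ≈ a * linComb r L I J
    linComb-scale a []            I J = sym (zeroʳ a)
    linComb-scale a ((b , w) ∷ L) I J =
      trans (+-cong (*-assoc a b _) (linComb-scale a L I J)) (sym (distribˡ a _ _))

    module _ {Q : Permutation′ n → Set} where

      span-resp : ∀ {X Y} → X ≋ Y → InSpan Q X → InSpan Q Y
      span-resp X≋Y (L , q , X≋L) = L , q , λ I J → trans (sym (X≋Y I J)) (X≋L I J)

      span-0 : InSpan Q zeroM
      span-0 = [] , [] , λ I J → refl

      span-generator : ∀ {w} → Q w → InSpan Q (KronPow r w)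
      span-generator {w} q = (1# , w) ∷ [] , q ∷ [] , λ I J →
        sym (trans (+-identityʳ _) (*-identityˡ _))

      span-+ : ∀ {X Y} → InSpan Q X → InSpan Q Y → InSpan Q (λ I J → X I J + Y I J)
      span-+ (L , qL , X≋L) (M , qM , Y≋M) = L ++ M , Allₚ.++⁺ qL qM , λ I J →
        trans (+-cong (X≋L I J) (Y≋M I J)) (sym (linComb-++ L M I J))

      span-* : ∀ a {X} → InSpan Q X → InSpan Q (λ I J → a * X I J)
      span-* a (L , qL , X≋L) = _ , Allₚ.map⁺ qL , λ I J →
        trans (*-congˡ (X≋L I J)) (sym (linComb-scale a L I J))

      span-sub : ∀ {X Y} → InSpan Q X → InSpan Q Y → InSpan Q (λ I J → X I J - Y I J)
      span-sub sX sY = span-+ sX (span-resp (λ I J → -1*x≈-x _) (span-* (- 1#) sY))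

      span-linComb : (∀ w → InSpan Q (KronPow r w)) → ∀ L → InSpan Q (linComb r L)
      span-linComb s []            = span-0
      span-linComb s ((a , w) ∷ L) = span-+ (span-* a (s w)) (span-linComb s L)

      opaque
        unfolding altΣ alt

        span-altΣ : ∀ {m} (X : Fin m → Mat n r) → (∀ i → InSpan Q (X i)) →
          InSpan Q (λ I J → altΣ (λ i → X i I J))
        span-altΣ {zero}  X s = span-0
        span-altΣ {suc m} X s = span-sub (s zero) (span-altΣ (X ∘ suc) (s ∘ suc))

        span-alt : ∀ {m} (F : Permutation′ m → Mat n r) → (∀ σ → InSpan Q (F σ)) →
          InSpan Q (λ I J → alt (λ σ → F σ I J))
        span-alt {zero}  F s = s id
        span-alt {suc m} F s = span-altΣ _ λ i →
          span-alt (λ σ → F (insert zero i σ)) (λ σ → s (insert zero i σ))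

        -- The identity term has sign plus, so it is the sum with the other terms removed. It is
        -- reached as an iterated `insert zero zero`, which agrees with `id` only pointwise; hence
        -- the existential.
        span-isolate-id : ∀ {m} (F : Permutation′ m → Mat n r) → (∀ σ → Moves σ → InSpan Q (F σ)) →
          InSpan Q (λ I J → alt (λ σ → F σ I J)) → ∃ λ ι → ι ≈ₚ id × InSpan Q (F ι)
        span-isolate-id {zero}  F s sum = id , (λ i → ≡.refl) , sum
        span-isolate-id {suc m} F s sum
          with ι , ι≈id , sι ← span-isolate-id (λ σ → F (insert zero zero σ))
            (λ { σ (j , σj≢j) → s (insert zero zero σ)
               (suc j , λ eq → σj≢j (Finₚ.suc-injective (≡.trans (≡.sym (insert-punchIn zero zero σ j)) eq))) })
            -- Adding back the terms with `zero` sent to some `suc i`, all of which move `zero`,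
            -- leaves the inner sum over permutations fixing `zero`.
            (span-resp (λ I J → x-y+y≈x _ _) (span-+ sum
              (span-altΣ _ λ i → span-alt (λ σ → F (insert zero (suc i) σ))
                (λ σ → s (insert zero (suc i) σ) (zero , λ ())))))
          = insert zero zero ι
          , (λ { zero → ≡.refl ; (suc j) → ≡.trans (insert-punchIn zero zero ι j) (≡.cong suc (ι≈id j)) })
          , sι

    -- The last hypothesis concerns the product, so that a term may drop out through either its
    -- entry or its coefficient.
    linComb-isolate : ∀ {a} {w : Permutation′ n} (L : List (k × Permutation′ n)) →
      AllPairs (λ p q → ¬ (proj₂ p ≈ₚ proj₂ q)) L → (a , w) ∈ L → ∀ I J →
      KronPow r w I J ≈ 1# →
      (∀ b v → (b , v) ∈ L → ¬ (v ≈ₚ w) → b * KronPow r v I J ≈ 0#) →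
      linComb r L I J ≈ a
    linComb-isolate (_ ∷ L) (w≉ ∷ _) (here ≡.refl) I J w≈1 other = trans
      (+-cong (trans (*-congˡ w≈1) (*-identityʳ _))
        (vanishing L λ b v ∈L → other b v (there ∈L) λ v≈w → All.lookup w≉ ∈L (λ i → ≡.sym (v≈w i))))
      (+-identityʳ _)
      where
      vanishing : ∀ M → (∀ b v → (b , v) ∈ M → b * KronPow r v I J ≈ 0#) → linComb r M I J ≈ 0#
      vanishing []            _ = refl
      vanishing ((b , v) ∷ M) z = trans
        (+-cong (z b v (here ≡.refl)) (vanishing M λ b v ∈M → z b v (there ∈M))) (+-identityʳ _)
    linComb-isolate ((b , v) ∷ L) (v≉ ∷ L-distinct) (there ∈L) I J w≈1 other = trans
      (+-cong (other b v (here ≡.refl) (All.lookup v≉ ∈L))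
        (linComb-isolate L L-distinct ∈L I J w≈1 λ b v ∈L′ → other b v (there ∈L′)))
      (+-identityˡ _)

  -- Spanning and independence of the good permutations

  -- ρ = opposite turns increasing subsequences into decreasing ones.
  module _ {n : ℕ} (r : ℕ) (ρ : Fin n → Fin n) (ρ-inj : Injective _≡_ _≡_ ρ) where

    word : Permutation′ n → Fin n → Fin n
    word w = ρ ∘ (w ⟨$⟩ʳ_)

    word-injective : ∀ w → Injective _≡_ _≡_ (word w)
    word-injective w = permute-injective w ∘ ρ-inj

    Good : Permutation′ n → Set
    Good w = IncSubseq (n ∸ r) (word w)

    good-or-blocks : ∀ w → Good w ⊎
      ∃₂ λ m (b : Fin n → Fin m) → m ℕ.+ r ℕ.< n × (∀ i j → i < j → b i ≡ b j → word w j < word w i)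
    good-or-blocks w with n ∸ r in eq
    -- With `r` at least `n` the empty subsequence suffices.
    ... | zero = inj₁ ((λ ()) , (λ ()) , (λ ()))
    ... | suc m with incSubseq-or-colouring (word w) (word-injective w) m
    ...   | inj₁ s = inj₁ s
    ...   | inj₂ (b , dec) = inj₂ (m , b , m+r<n , dec)
      where
      r≤n : r ≤ n
      r≤n with ℕₚ.≤-total r n
      ... | inj₁ r≤n = r≤n
      ... | inj₂ n≤r with () ← ≡.trans (≡.sym eq) (ℕₚ.m≤n⇒m∸n≡0 n≤r)
      m+r<n : m ℕ.+ r ℕ.< n
      m+r<n = ℕₚ.≤-reflexive (≡.trans (≡.cong (ℕ._+ r) (≡.sym eq)) (ℕₚ.m∸n+n≡m r≤n))

    -- Induction along the lexicographic order of words: the vanishing alternating sum expresses the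
    -- term of `w` through lexicographically smaller ones.
    spans : ∀ w → Acc _<_ (funToFin (word w)) → InSpan {n} {r} Good (KronPow r w)
    spans w (acc rec) with good-or-blocks w
    ... | inj₁ good = span-generator good
    ... | inj₂ (m , b , m+r<n , dec) =
      let ι , ι≈id , sι = span-isolate-id F lower
            (span-resp (λ I J → sym (alt-blocks-vanishes b m+r<n w I J)) span-0)
      in span-resp (λ I J → trans
           (*-cong (∏-1 λ j → δ-refl (≡.cong b (≡.sym (ι≈id j))))
             (KronPow-cong {v = ι ∘ₚ w} {w} (λ j → ≡.cong (w ⟨$⟩ʳ_) (ι≈id j)) I J))
           (*-identityˡ _)) sι
      where
      F : Permutation′ n → Mat n r
      F σ I J = blockδ {n} {r} b σ * KronPow r (σ ∘ₚ w) I J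
      lower : ∀ σ → Moves σ → InSpan Good (F σ)
      lower σ moves with Finₚ.all? (λ j → b j ≟ b (σ ⟨$⟩ʳ j))
      -- `alt` runs over all permutations; those breaking a block have coefficient zero and need no
      -- induction hypothesis.
      ... | yes pres = span-* _ (spans (σ ∘ₚ w) (rec (lex-decrease (word w) b dec σ moves pres)))
      ... | no ¬pres with j , bj≢ ← Finₚ.¬∀⟶∃¬ n _ (λ j → b j ≟ b (σ ⟨$⟩ʳ j)) ¬pres =
        span-resp (λ I J → sym (trans (*-congʳ (∏-0 j (δ-≢ bj≢))) (zeroˡ _))) span-0

    -- Induction from the lexicographically largest word downwards. In the entry at `(w ∘ J , J)`
    -- only permutations agreeing with `w` on `J` contribute; those other than `w` are larger, so
    -- their coefficients are already zero.
    independent : Fin n → (L : List (k × Permutation′ n)) → All (Good ∘ proj₂) L →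
      AllPairs (λ p q → ¬ (proj₂ p ≈ₚ proj₂ q)) L → linComb r L ≋ zeroM →
      ∀ a w → (a , w) ∈ L → Acc _>_ (funToFin (word w)) → a ≈ 0#
    independent pad L goods distinct L≋0 a w ∈L (acc rec)
      with s@(f , mono , _) ← All.lookup goods ∈L
      with J , covers ← cover-complement r f pad (strictMono⇒injective f mono)
             -- The bound `n ≤ r + (n ∸ r)` survives truncated subtraction.
             (≡.subst (n ≤_) (ℕₚ.+-comm r (n ∸ r)) (ℕₚ.m≤n+m∸n n r))
      = trans (sym (linComb-isolate L distinct ∈L I J (KronPow-1 w I J λ t → ≡.refl) others)) (L≋0 I J)
      where
      I : Fin r → Fin n
      I t = w ⟨$⟩ʳ J t
      others : ∀ b v → (b , v) ∈ L → ¬ (v ≈ₚ w) → b * KronPow r v I J ≈ 0#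
      others b v ∈L′ v≉w with Finₚ.all? (λ t → I t ≟ (v ⟨$⟩ʳ J t))
      ... | no ¬agree with t , neq ← Finₚ.¬∀⟶∃¬ r _ (λ t → I t ≟ (v ⟨$⟩ʳ J t)) ¬agree =
        trans (*-congˡ (KronPow-0 v I J t neq)) (zeroʳ b)
      ... | yes agree = trans (*-congʳ (independent pad L goods distinct L≋0 b v ∈L′ (rec w<v))) (zeroˡ _)
        where
        σ : Permutation′ n
        -- Chosen so that `w` after `σ` is `v`; it fixes `J` because `v` and `w` agree there.
        σ = v ∘ₚ flip w
        w∘σ : ∀ j → w ⟨$⟩ʳ (σ ⟨$⟩ʳ j) ≡ v ⟨$⟩ʳ j
        w∘σ j = inverseʳ w
        moves : Moves σ
        moves = Finₚ.¬∀⟶∃¬ n _ (λ j → (σ ⟨$⟩ʳ j) ≟ j) λ σ≈id → v≉w λ j →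
          ≡.trans (≡.sym (w∘σ j)) (≡.cong (w ⟨$⟩ʳ_) (σ≈id j))
        w<v : funToFin (word w) < funToFin (word v)
        w<v = ≡.subst (funToFin (word w) <_) (funToFin-cong λ j → ≡.cong ρ (w∘σ j))
          (lex-increase (word w) s J covers σ moves
            λ t → ≡.trans (≡.cong (w ⟨$⟩ˡ_) (≡.sym (agree t))) (inverseˡ w))

    good-basis : Fin n → IsBasisOfIm n r Good
    good-basis pad = span-linComb (λ w → spans w (<-wellFounded _)) ,
      λ L goods distinct L≋0 → All.tabulate λ {(a , w)} ∈L →
        independent pad L goods distinct L≋0 a w ∈L (>-wellFounded _)

  basis-cong : ∀ {n r} {Q Q′ : Permutation′ n → Set} → (∀ w → Q w → Q′ w) → (∀ w → Q′ w → Q w) →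
    IsBasisOfIm n r Q → IsBasisOfIm n r Q′
  basis-cong to from (span , indep) =
    (λ L → map₂ (λ (q , eq) → All.map (to _) q , eq) (span L)) ,
    (λ L q → indep L (All.map (from _) q))

-- Order reversal and decreasing subsequences

opposite-< : ∀ {n} {i j : Fin n} → i < j → opposite j < opposite i
opposite-< {n} {i} {j} i<j = ≡.subst₂ ℕ._<_ (≡.sym (Finₚ.opposite-prop j)) (≡.sym (Finₚ.opposite-prop i))
  (ℕₚ.∸-monoʳ-< (ℕ.s<s i<j) (Finₚ.toℕ<n j))

opposite-<⁻¹ : ∀ {n} {i j : Fin n} → opposite i < opposite j → j < i
opposite-<⁻¹ {i = i} {j} = ≡.subst₂ _<_ (Finₚ.opposite-involutive j) (Finₚ.opposite-involutive i) ∘ opposite-<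

opposite-injective : ∀ {n} → Injective _≡_ _≡_ (opposite {n})
opposite-injective {x = i} {j} eq =
  ≡.trans (≡.sym (Finₚ.opposite-involutive i)) (≡.trans (≡.cong opposite eq) (Finₚ.opposite-involutive j))

theorem1 : ∀ {c ℓ : Level} (K : CommutativeRing c ℓ) (n r : ℕ) → 1 ≤ n → 1 ≤ r →
    Kron.IsBasisOfIm K n r (HasIncSubseq (n ∸ r)) × Kron.IsBasisOfIm K n r (HasDecSubseq (n ∸ r))
theorem1 K n@(suc _) r _ _ =
  -- With the identity as `ρ`, `Good` is `HasIncSubseq` by definition; `zero` is the padding
  -- position.
  good-basis K r (λ x → x) (λ eq → eq) zero ,
  basis-cong K
    (λ { w (f , mono , inc) → f , mono , λ i j i<j → opposite-<⁻¹ (inc i j i<j) })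
    (λ { w (f , mono , dec) → f , mono , λ i j i<j → opposite-< (dec i j i<j) })
    (good-basis K r opposite opposite-injective zero)
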